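{- Let $F_5$ be the $3$-graph on vertex set $\{1,2,3,4,5\}$ with $3$-edges $123, 124, 345$. For every integer $n\ge 6$, $$\mathrm{co^+ex}(n,F_5)=\left\lfloor\frac n3\right\rfloor .$$
   Context: A $3$-graph is a finite $3$-uniform hypergraph; an edge is written as the concatenation of its vertices. The minimum positive co-degree $\delta_2^+(H)$ of a non-empty $3$-graph $H$ is the maximum $k$ such that every pair of vertices contained in some edge of $H$ is contained in at least $k$ distinct edges of $H$. A hypergraph is $F$-free if it has no (not necessarily induced) subhypergraph isomorphic to $F$. $\mathrm{co^+ex}(n,F)$ is the maximum of $\delta_2^+(H)$ over all non-empty $n$-vertex $F$-free $3$-graphs $H$. -}

module Defs where

open import Data.Fin using (Fin; #_)
open import Data.Fin.Subset using (Subset; _∈_; ∣_∣; ⁅_⁆; _∪_; ⋃)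
open import Data.Fin.Subset.Properties using (_∈?_)
open import Data.Bool.Properties using () renaming (_≟_ to _≟ᵇ_)
open import Data.List using (List; []; _∷_; map; filter; allFin)
open import Data.List.Relation.Unary.All as All using (All; []; _∷_)
open import Data.List.Membership.Propositional using () renaming (_∈_ to _∈ˡ_)
import Data.List.Membership.DecPropositional as DecMembership
open import Data.Nat using (ℕ; _≤_)
open import Data.Product using (Σ; ∃; _×_)
open import Data.Vec.Properties using (≡-dec)
open import Function using (_∘_)
open import Function.Definitions using (Injective)
open import Level using (0ℓ)
open import Relation.Binary.PropositionalEquality using (_≡_; _≢_; refl)
open import Relation.Nullary using (¬_)
open import Relation.Unary using (Pred; Decidable)

record 3-Graph (n : ℕ) : Set₁ where
  field
    Edge    : Pred (Subset n) 0ℓ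
    Edge?   : Decidable Edge
    uniform : ∀ {e} → Edge e → ∣ e ∣ ≡ 3

open 3-Graph public

NonEmpty : ∀ {n} → 3-Graph n → Set
NonEmpty H = ∃ (Edge H)

IsMax : ∀ {ℓ} → Pred ℕ ℓ → Pred ℕ ℓ
IsMax P k = P k × (∀ j → P j → j ≤ k)

EdgeContaining : ∀ {n} → 3-Graph n → Fin n → Fin n → Pred (Subset n) 0ℓ
EdgeContaining H x y e = Edge H e × x ∈ e × y ∈ e

AtLeast : ∀ {a p} {A : Set a} → ℕ → Pred A p → Set _
AtLeast {A = A} k P =
  Σ (Fin k → A) λ f → Injective _≡_ _≡_ f × (∀ i → P (f i))

PositiveCodegree≥ : ∀ {n} → 3-Graph n → Pred ℕ 0ℓ
PositiveCodegree≥ H k =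
  ∀ x y → x ≢ y → ∃ (EdgeContaining H x y) → AtLeast k (EdgeContaining H x y)

-- δ₂⁺ H ≔ d  expresses that d is the minimum positive co-degree of H.
-- For an empty H every k satisfies PositiveCodegree≥ H, so no such d exists.
δ₂⁺_≔_ : ∀ {n} → 3-Graph n → ℕ → Set
δ₂⁺ H ≔ d = IsMax (PositiveCodegree≥ H) d

image : ∀ {m n} → (Fin m → Fin n) → Subset m → Subset n
image {m} φ e = ⋃ (map (⁅_⁆ ∘ φ) (filter (_∈? e) (allFin m)))

-- A subhypergraph of H isomorphic to F is the same thing as the image of F
-- under an injection of the vertices that sends edges to edges; non-edges of F
-- are unconstrained because the subhypergraph need not be induced.
Contains : ∀ {m n} → 3-Graph n → 3-Graph m → Set
Contains {m} {n} H F =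
  Σ (Fin m → Fin n) λ φ →
    Injective _≡_ _≡_ φ × (∀ e → Edge F e → Edge H (image φ e))

_-Free_ : ∀ {m n} → 3-Graph m → 3-Graph n → Set
F -Free H = ¬ Contains H F

-- co⁺ex⟨ n , F ⟩≔ d  expresses that co⁺ex(n, F) is defined and equal to d.
co⁺ex⟨_,_⟩≔_ : ∀ {m} → ℕ → 3-Graph m → ℕ → Set₁
co⁺ex⟨ n , F ⟩≔ d =
  IsMax (λ k → Σ (3-Graph n) λ H → NonEmpty H × F -Free H × δ₂⁺ H ≔ k) d

triple : ∀ {n} → Fin n → Fin n → Fin n → Subset n
triple x y z = ⁅ x ⁆ ∪ ⁅ y ⁆ ∪ ⁅ z ⁆

-- The vertices 1, …, 5 are represented by # 0, …, # 4.
F₅-edges : List (Subset 5)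
F₅-edges =
    triple (# 0) (# 1) (# 2)
  ∷ triple (# 0) (# 1) (# 3)
  ∷ triple (# 2) (# 3) (# 4)
  ∷ []

F₅ : 3-Graph 5
F₅ = record
  { Edge    = _∈ˡ F₅-edges
  ; Edge?   = λ e → DecMembership._∈?_ (≡-dec _≟ᵇ_) e F₅-edges
  ; uniform = All.lookup {P = λ e → ∣ e ∣ ≡ 3} (refl ∷ refl ∷ refl ∷ [])
  }

{-# OPTIONS --safe #-}
-- Upper bound: let H be F₅-free with every positive co-degree at least k ≥ 3.
-- Two neighbours u, v of a covered pair xy cannot themselves lie in a common
-- edge, because uv would then have a third neighbour outside {x, y} and
-- complete a copy of F₅. Hence the three link sets N(ab), N(ac), N(bc) of an
-- edge abc are pairwise disjoint (d ∈ N(ab) ∩ N(ac) would make c and d two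
-- neighbours of ab inside the edge acd), and 3k ≤ n. If k ≤ 2, then k ≤ ⌊n/3⌋
-- because n ≥ 6.
--
-- Lower bound: in the complete 3-partite 3-graph with parts of size at least
-- ⌊n/3⌋, the vertices 1, 2, 3, 4 of a copy of F₅ would need four colours.
module Submission where

open import Data.Bool using (if_then_else_)
open import Data.Fin using (Fin; zero; suc; toℕ; combine; remQuot; inject≤; _≟_)
open import Data.Fin.Patterns using (0F; 1F; 2F; 3F)
open import Data.Fin.Properties
  using (any?; all?; injective⇒≤; pigeonhole; <⇒≢; toℕ<n; toℕ-injective; toℕ-fromℕ<;
         toℕ-inject≤; inject≤-injective; toℕ-combine; combine-injectiveˡ; combine-remQuot)
open import Data.Fin.Subset
  using (Subset; inside; outside; _∈_; _∉_; _⊆_; ∣_∣; ⁅_⁆; _∪_; ⊥)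
open import Data.Fin.Subset.Properties
open import Data.List.Relation.Unary.Any using (here; there)
open import Data.Nat using (ℕ; suc; _+_; _*_; _≤_; _<_; _/_; z≤n; s≤s)
open import Data.Nat.DivMod
  using (_mod_; _%_; m/n*n≤m; m*n/n≡m; /-monoˡ-≤; m<n⇒m%n≡m; [m+kn]%n≡m%n)
open import Data.Nat.Properties as ℕ using (≤-refl; ≤-trans; ≤-reflexive)
open import Data.Product using (∃; _×_; _,_; proj₁; proj₂)
open import Data.Sum using (_⊎_; inj₁; inj₂; [_,_]′)
open import Data.Vec using ([]; _∷_; lookup; here; there)
open import Data.Vec.Relation.Unary.All using ([]; _∷_)
open import Data.Vec.Relation.Unary.AllPairs using ([]; _∷_)
open import Data.Vec.Relation.Unary.Unique.Propositional using (Unique)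
open import Data.Vec.Relation.Unary.Unique.Propositional.Properties using (lookup-injective)
open import Function using (_∘_; id)
open import Function.Definitions using (Injective)
open import Relation.Binary.PropositionalEquality
  using (_≡_; _≢_; refl; sym; trans; cong; subst; subst₂; ≢-sym; module ≡-Reasoning)
open import Relation.Nullary
  using (¬_; does; yes; no; contradiction; ¬?; _×-dec_; _→-dec_; decidable-stable)
open import Relation.Unary using (Pred)

open import Defs

private variable
  k m n : ℕ

-- Counting with injections between finite types.

avoid-two : {f : Fin k → Fin n} → Injective _≡_ _≡_ f → 3 ≤ k →
            ∀ x y → ∃ λ i → f i ≢ x × f i ≢ y
avoid-two {k} {f = f} f-inj 3≤k x y
  with any? (λ i → ¬? (f i ≟ x) ×-dec ¬? (f i ≟ y))
... | yes found = found
-- If every value is `x` or `y`, the test for being equal to `x` sorts at least three indices into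
-- two classes, and two indices of the same class have the same value under `f`.
... | no none with pigeonhole 3≤k (λ i → if does (f i ≟ x) then 0F else 1F)
... | i , j , i<j , same with f i ≟ x | f j ≟ x | same
... | yes fi≡x | yes fj≡x | _ = contradiction (f-inj (trans fi≡x (sym fj≡x))) (<⇒≢ i<j)
... | no  fi≢x | no  fj≢x | _ = contradiction (f-inj (trans (≡y fi≢x) (sym (≡y fj≢x)))) (<⇒≢ i<j)
  where
  ≡y : ∀ {i} → f i ≢ x → f i ≡ y
  ≡y fi≢x = decidable-stable (f _ ≟ y) (λ fi≢y → none (_ , fi≢x , fi≢y))

-- The `m` injections glue to a single one on pairs of indices, encoded in `Fin (m * k)` by
-- `remQuot`; disjointness recovers the first index and injectivity the second.
disjoint-injections⇒*≤ : {f : Fin m → Fin k → Fin n} →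
  (∀ i → Injective _≡_ _≡_ (f i)) → (∀ {i i′ j j′} → f i j ≡ f i′ j′ → i ≡ i′) → m * k ≤ n
disjoint-injections⇒*≤ {m} {k} {f = f} f-inj f-disjoint = injective⇒≤ {f = g} g-injective
  where
  g : Fin (m * k) → Fin _
  g ij = f (proj₁ (remQuot {m} k ij)) (proj₂ (remQuot {m} k ij))

  uncurried : ∀ {i i′ j j′} → f i j ≡ f i′ j′ → combine i j ≡ combine i′ j′
  uncurried {i} eq with refl ← f-disjoint eq = cong (combine i) (f-inj i eq)

  g-injective : Injective _≡_ _≡_ g
  g-injective {ij} {ij′} eq =
    trans (sym (combine-remQuot {m} k ij)) (trans (uncurried eq) (combine-remQuot {m} k ij′))

-- Cardinalities of subsets and the shape of three-element sets.

∣⁅x⁆∪p∣≡1+∣p∣ : ∀ {x : Fin n} {p} → x ∉ p → ∣ ⁅ x ⁆ ∪ p ∣ ≡ suc ∣ p ∣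
∣⁅x⁆∪p∣≡1+∣p∣ {x = zero}  {inside  ∷ p} x∉p = contradiction here x∉p
∣⁅x⁆∪p∣≡1+∣p∣ {x = zero}  {outside ∷ p} x∉p = cong (suc ∘ ∣_∣) (∪-identityˡ p)
∣⁅x⁆∪p∣≡1+∣p∣ {x = suc x} {inside  ∷ p} x∉p = cong suc (∣⁅x⁆∪p∣≡1+∣p∣ (x∉p ∘ there))
∣⁅x⁆∪p∣≡1+∣p∣ {x = suc x} {outside ∷ p} x∉p = ∣⁅x⁆∪p∣≡1+∣p∣ (x∉p ∘ there)

∣p∣<∣q∣⇒∃∈q∉p : (p q : Subset n) → ∣ p ∣ < ∣ q ∣ → ∃ λ x → x ∈ q × x ∉ p
∣p∣<∣q∣⇒∃∈q∉p p q ∣p∣<∣q∣ with any? (λ x → (x ∈? q) ×-dec ¬? (x ∈? p))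
... | yes found = found
... | no none = contradiction (p⊆q⇒∣p∣≤∣q∣ q⊆p) (ℕ.<⇒≱ ∣p∣<∣q∣)
  where
  q⊆p : q ⊆ p
  q⊆p {x} x∈q = decidable-stable (x ∈? p) (λ x∉p → none (x , x∈q , x∉p))

p⊆q∧∣p∣≡∣q∣⇒p≡q : {p q : Subset n} → p ⊆ q → ∣ p ∣ ≡ ∣ q ∣ → p ≡ q
p⊆q∧∣p∣≡∣q∣⇒p≡q {p = p} p⊆q ∣p∣≡∣q∣ = ⊆-antisym p⊆q λ {x} x∈q →
  decidable-stable (x ∈? p) λ x∉p →
    ℕ.<⇒≢ (p⊂q⇒∣p∣<∣q∣ (p⊆q , x , x∈q , x∉p)) ∣p∣≡∣q∣

∈⁅x⁆∪p⁻ : ∀ {w x : Fin n} {p} → w ∈ ⁅ x ⁆ ∪ p → w ≡ x ⊎ w ∈ p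
∈⁅x⁆∪p⁻ {x = x} {p} w∈ with x∈p∪q⁻ ⁅ x ⁆ p w∈
... | inj₁ w∈⁅x⁆ = inj₁ (x∈⁅y⁆⇒x≡y x w∈⁅x⁆)
... | inj₂ w∈p   = inj₂ w∈p

∣pair∣≡2 : ∀ {x y : Fin n} → x ≢ y → ∣ ⁅ x ⁆ ∪ ⁅ y ⁆ ∣ ≡ 2
∣pair∣≡2 {y = y} x≢y = trans (∣⁅x⁆∪p∣≡1+∣p∣ (x≢y⇒x∉⁅y⁆ x≢y)) (cong suc (∣⁅x⁆∣≡1 y))

module _ {x y z : Fin n} where

  first∈triple : x ∈ triple x y z
  first∈triple = x∈p∪q⁺ (inj₁ (x∈⁅x⁆ x))

  second∈triple : y ∈ triple x y z
  second∈triple = x∈p∪q⁺ (inj₂ (x∈p∪q⁺ (inj₁ (x∈⁅x⁆ y))))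

  third∈triple : z ∈ triple x y z
  third∈triple = x∈p∪q⁺ (inj₂ (x∈p∪q⁺ (inj₂ (x∈⁅x⁆ z))))

  ∈-triple⁻ : ∀ {w} → w ∈ triple x y z → w ≡ x ⊎ w ≡ y ⊎ w ≡ z
  ∈-triple⁻ w∈ with ∈⁅x⁆∪p⁻ w∈
  ... | inj₁ w≡x = inj₁ w≡x
  ... | inj₂ w∈yz with ∈⁅x⁆∪p⁻ w∈yz
  ... | inj₁ w≡y = inj₂ (inj₁ w≡y)
  ... | inj₂ w∈z = inj₂ (inj₂ (x∈⁅y⁆⇒x≡y z w∈z))

  triple-swap : triple x y z ≡ triple y x z
  triple-swap = begin
    ⁅ x ⁆ ∪ ⁅ y ⁆ ∪ ⁅ z ⁆    ≡⟨ ∪-assoc ⁅ x ⁆ ⁅ y ⁆ ⁅ z ⁆ ⟨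
    (⁅ x ⁆ ∪ ⁅ y ⁆) ∪ ⁅ z ⁆  ≡⟨ cong (_∪ ⁅ z ⁆) (∪-comm ⁅ x ⁆ ⁅ y ⁆) ⟩
    (⁅ y ⁆ ∪ ⁅ x ⁆) ∪ ⁅ z ⁆  ≡⟨ ∪-assoc ⁅ y ⁆ ⁅ x ⁆ ⁅ z ⁆ ⟩
    ⁅ y ⁆ ∪ ⁅ x ⁆ ∪ ⁅ z ⁆    ∎
    where open ≡-Reasoning

  triple-rotate : triple x y z ≡ triple y z x
  triple-rotate = trans (∪-comm ⁅ x ⁆ (⁅ y ⁆ ∪ ⁅ z ⁆)) (∪-assoc ⁅ y ⁆ ⁅ z ⁆ ⁅ x ⁆)

  -- image of a triple unfolds to a union that ends in ⊥.
  ∪-⊥≡triple : ⁅ x ⁆ ∪ ⁅ y ⁆ ∪ ⁅ z ⁆ ∪ ⊥ ≡ triple x y z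
  ∪-⊥≡triple = cong (λ p → ⁅ x ⁆ ∪ ⁅ y ⁆ ∪ p) (∪-identityʳ ⁅ z ⁆)

  ∣triple∣≡3 : x ≢ y → x ≢ z → y ≢ z → ∣ triple x y z ∣ ≡ 3
  ∣triple∣≡3 x≢y x≢z y≢z = begin
    ∣ ⁅ x ⁆ ∪ ⁅ y ⁆ ∪ ⁅ z ⁆ ∣  ≡⟨ ∣⁅x⁆∪p∣≡1+∣p∣ ([ x≢y , x≢z ∘ x∈⁅y⁆⇒x≡y z ]′ ∘ ∈⁅x⁆∪p⁻) ⟩
    suc ∣ ⁅ y ⁆ ∪ ⁅ z ⁆ ∣      ≡⟨ cong suc (∣pair∣≡2 y≢z) ⟩
    3                          ∎
    where open ≡-Reasoning

-- Lets distinct third vertices on a fixed pair give distinct edges.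
triple-injective : ∀ {x y z z′ : Fin n} → z ≢ x → z ≢ y → triple x y z ≡ triple x y z′ → z ≡ z′
triple-injective z≢x z≢y eq with ∈-triple⁻ (subst (_ ∈_) eq third∈triple)
... | inj₁ z≡x         = contradiction z≡x z≢x
... | inj₂ (inj₁ z≡y)  = contradiction z≡y z≢y
... | inj₂ (inj₂ z≡z′) = z≡z′

-- The pair has only two elements, so `e` has a further one; the resulting triple lies in `e` and
-- has the same size, hence equals it.
∣e∣≡3⇒triple : ∀ {x y : Fin n} {e} → ∣ e ∣ ≡ 3 → x ≢ y → x ∈ e → y ∈ e →
               ∃ λ z → z ≢ x × z ≢ y × e ≡ triple x y z
∣e∣≡3⇒triple {x = x} {y} {e} ∣e∣≡3 x≢y x∈e y∈e
  with z , z∈e , z∉xy ← ∣p∣<∣q∣⇒∃∈q∉p (⁅ x ⁆ ∪ ⁅ y ⁆) e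
      (subst (_< ∣ e ∣) (sym (∣pair∣≡2 x≢y)) (≤-reflexive (sym ∣e∣≡3)))
  = z , z≢x , z≢y , sym (p⊆q∧∣p∣≡∣q∣⇒p≡q xyz⊆e
      (trans (∣triple∣≡3 x≢y (≢-sym z≢x) (≢-sym z≢y)) (sym ∣e∣≡3)))
  where
  z≢x : z ≢ x
  z≢x refl = z∉xy (x∈p∪q⁺ (inj₁ (x∈⁅x⁆ x)))

  z≢y : z ≢ y
  z≢y refl = z∉xy (x∈p∪q⁺ (inj₂ (x∈⁅x⁆ y)))

  xyz⊆e : triple x y z ⊆ e
  xyz⊆e w∈ with ∈-triple⁻ w∈
  ... | inj₁ refl        = x∈e
  ... | inj₂ (inj₁ refl) = y∈e
  ... | inj₂ (inj₂ refl) = z∈e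

∣e∣≡3⇒∃triple : {e : Subset n} → ∣ e ∣ ≡ 3 →
                ∃ λ x → ∃ λ y → ∃ λ z → x ≢ y × z ≢ x × z ≢ y × e ≡ triple x y z
∣e∣≡3⇒∃triple {n} {e} ∣e∣≡3
  with x , x∈e , _ ← ∣p∣<∣q∣⇒∃∈q∉p ⊥ e (subst₂ _<_ (sym (∣⊥∣≡0 n)) (sym ∣e∣≡3) (s≤s z≤n))
  with y , y∈e , y∉x ← ∣p∣<∣q∣⇒∃∈q∉p ⁅ x ⁆ e (subst₂ _<_ (sym (∣⁅x⁆∣≡1 x)) (sym ∣e∣≡3) (s≤s (s≤s z≤n)))
  with x≢y ← ≢-sym (x∉⁅y⁆⇒x≢y y∉x)
  = x , y , _ , x≢y , proj₂ (∣e∣≡3⇒triple ∣e∣≡3 x≢y x∈e y∈e)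

-- Upper bound: links of pairs in an F₅-free 3-graph.

module _ (H : 3-Graph n) where

  -- Membership of `z` in the link N(xy), with its distinctness from `x` and `y` carried along.
  Neighbour : Fin n → Fin n → Pred (Fin n) _
  Neighbour x y z = z ≢ x × z ≢ y × Edge H (triple x y z)

  neighbour-swap : ∀ {x y z} → Neighbour x y z → Neighbour y x z
  neighbour-swap (z≢x , z≢y , xyz) = z≢y , z≢x , subst (Edge H) triple-swap xyz

  neighbour-rotate : ∀ {x y z} → x ≢ y → Neighbour x y z → Neighbour y z x
  neighbour-rotate x≢y (z≢x , z≢y , xyz) =
    x≢y , ≢-sym z≢x , subst (Edge H) triple-rotate xyz

  -- Passes from counting edges to counting vertices: an edge through `x` and `y` is determined by
  -- its third vertex, so distinct edges have distinct third vertices.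
  neighbours : PositiveCodegree≥ H k → ∀ {x y z} → x ≢ y → Neighbour x y z →
               AtLeast k (Neighbour x y)
  neighbours deg {x} {y} x≢y (_ , _ , xyz)
    with f , f-inj , f-edge ← deg x y x≢y (_ , xyz , first∈triple , second∈triple)
    = proj₁ ∘ third , third-injective , proj₂ ∘ proj₂ ∘ third
    where
    third : ∀ i → ∃ λ z → f i ≡ triple x y z × Neighbour x y z
    third i
      with fi , x∈fi , y∈fi ← f-edge i
      with z , z≢x , z≢y , fi≡xyz ← ∣e∣≡3⇒triple (uniform H fi) x≢y x∈fi y∈fi
      = z , fi≡xyz , z≢x , z≢y , subst (Edge H) fi≡xyz fi

    f≡triple : ∀ i → f i ≡ triple x y (proj₁ (third i))
    f≡triple = proj₁ ∘ proj₂ ∘ third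

    third-injective : Injective _≡_ _≡_ (proj₁ ∘ third)
    third-injective {i} {j} eq =
      f-inj (trans (f≡triple i) (trans (cong (triple x y) eq) (sym (f≡triple j))))

  F₅-contained : ∀ {x y u v w} → Unique (x ∷ y ∷ u ∷ v ∷ w ∷ []) →
                 Edge H (triple x y u) → Edge H (triple x y v) → Edge H (triple u v w) →
                 Contains H F₅
  F₅-contained {x} {y} {u} {v} {w} distinct xyu xyv uvw =
    lookup (x ∷ y ∷ u ∷ v ∷ w ∷ []) , lookup-injective distinct _ _ , λ where
      _ (here refl)                 → subst (Edge H) (sym ∪-⊥≡triple) xyu
      _ (there (here refl))         → subst (Edge H) (sym ∪-⊥≡triple) xyv
      _ (there (there (here refl))) → subst (Edge H) (sym ∪-⊥≡triple) uvw

  module _ (F₅-free : F₅ -Free H) (deg : PositiveCodegree≥ H k) (3≤k : 3 ≤ k) where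

    neighbours-not-covered : ∀ {x y u v w} → x ≢ y → u ≢ v →
      Neighbour x y u → Neighbour x y v → ¬ Neighbour u v w
    neighbours-not-covered {x} {y} x≢y u≢v (u≢x , u≢y , xyu) (v≢x , v≢y , xyv) uv∼w
      with f , f-inj , f-neighbour ← neighbours deg u≢v uv∼w
      -- The given `w` may be `x` or `y`; among at least three neighbours of the pair `u`, `v`, one
      -- avoids both and serves as vertex 5 of F₅.
      with i , w≢x , w≢y ← avoid-two f-inj 3≤k x y
      with w≢u , w≢v , uvw ← f-neighbour i
      = F₅-free (F₅-contained distinct xyu xyv uvw)
      where
      distinct = (x≢y ∷ ≢-sym u≢x ∷ ≢-sym v≢x ∷ ≢-sym w≢x ∷ [])
               ∷ (≢-sym u≢y ∷ ≢-sym v≢y ∷ ≢-sym w≢y ∷ [])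
               ∷ (u≢v ∷ ≢-sym w≢u ∷ [])
               ∷ (≢-sym w≢v ∷ [])
               ∷ [] ∷ []

    links-disjoint : ∀ {x y z w} → x ≢ y → Neighbour x y z → Neighbour x y w → ¬ Neighbour x z w
    links-disjoint x≢y xy∼z@(z≢x , _) xy∼w xz∼w@(_ , w≢z , _) =
      -- The edge `xzw` covers the pair `z`, `w` of neighbours of `xy`, with `x` as its third
      -- vertex.
      neighbours-not-covered x≢y (≢-sym w≢z) xy∼z xy∼w (neighbour-rotate (≢-sym z≢x) xz∼w)

    3*k≤n : NonEmpty H → 3 * k ≤ n
    3*k≤n (e , e∈H)
      with a , b , c , a≢b , c≢a , c≢b , refl ← ∣e∣≡3⇒∃triple {e = e} (uniform H e∈H)
      -- Rotating the one edge makes each of its three pairs a covered pair, so each has a link of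
      -- size at least `k`.
      with ab∼c ← (c≢a , c≢b , e∈H)
      with bc∼a ← neighbour-rotate a≢b ab∼c
      with ca∼b ← neighbour-rotate (≢-sym c≢b) bc∼a
      with f , f-inj , ab∼f ← neighbours deg a≢b ab∼c
      with g , g-inj , bc∼g ← neighbours deg (≢-sym c≢b) bc∼a
      with h , h-inj , ca∼h ← neighbours deg c≢a ca∼b
      = disjoint-injections⇒*≤ {f = family} injective disjoint
      where
      family : Fin 3 → Fin k → Fin n
      family 0F = f
      family 1F = g
      family 2F = h

      injective : ∀ i → Injective _≡_ _≡_ (family i)
      injective 0F = f-inj
      injective 1F = g-inj
      injective 2F = h-inj

      -- Any two of the pairs `ab`, `bc`, `ca` share a vertex; the swaps bring it to the front,
      -- where `links-disjoint` expects it.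
      f≢g : ∀ i j → f i ≢ g j
      f≢g i j eq = links-disjoint (≢-sym a≢b) (neighbour-swap ab∼c)
        (neighbour-swap (ab∼f i)) (subst (Neighbour b c) (sym eq) (bc∼g j))

      g≢h : ∀ i j → g i ≢ h j
      g≢h i j eq = links-disjoint c≢b (neighbour-swap bc∼a)
        (neighbour-swap (bc∼g i)) (subst (Neighbour c a) (sym eq) (ca∼h j))

      h≢f : ∀ i j → h i ≢ f j
      h≢f i j eq = links-disjoint (≢-sym c≢a) (neighbour-swap ca∼b)
        (neighbour-swap (ca∼h i)) (subst (Neighbour a b) (sym eq) (ab∼f j))

      disjoint : ∀ {i i′ j j′} → family i j ≡ family i′ j′ → i ≡ i′
      disjoint {0F} {0F} _  = refl
      disjoint {0F} {1F} eq = contradiction eq (f≢g _ _)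
      disjoint {0F} {2F} eq = contradiction (sym eq) (h≢f _ _)
      disjoint {1F} {0F} eq = contradiction (sym eq) (f≢g _ _)
      disjoint {1F} {1F} _  = refl
      disjoint {1F} {2F} eq = contradiction eq (g≢h _ _)
      disjoint {2F} {0F} eq = contradiction eq (h≢f _ _)
      disjoint {2F} {1F} eq = contradiction (sym eq) (g≢h _ _)
      disjoint {2F} {2F} _  = refl

F₅-free⇒k≤n/3 : (H : 3-Graph n) → 6 ≤ n → NonEmpty H → F₅ -Free H →
                PositiveCodegree≥ H k → k ≤ n / 3
F₅-free⇒k≤n/3 {n} {k} H 6≤n nonEmpty F₅-free deg with k ℕ.≤? 2
... | yes k≤2 = ≤-trans k≤2 (/-monoˡ-≤ 3 6≤n)
... | no  k≰2 = begin
  k          ≡⟨ m*n/n≡m k 3 ⟨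
  k * 3 / 3  ≡⟨ cong (_/ 3) (ℕ.*-comm k 3) ⟩
  3 * k / 3  ≤⟨ /-monoˡ-≤ 3 (3*k≤n H F₅-free deg (ℕ.≰⇒> k≰2) nonEmpty) ⟩
  n / 3      ∎
  where open ℕ.≤-Reasoning

-- Lower bound: complete 3-partite 3-graphs.

module _ (colour : Fin n → Fin 3) where

  -- Injectivity of `colour` on `e`, phrased over all vertices so that a finite search decides it.
  -- Together with `∣ e ∣ ≡ 3` it makes `e` take one vertex from each part.
  Rainbow : Pred (Subset n) _
  Rainbow e = ∀ x y → x ∈ e → y ∈ e → colour x ≡ colour y → x ≡ y

  complete3Partite : 3-Graph n
  complete3Partite = record
    { Edge    = λ e → ∣ e ∣ ≡ 3 × Rainbow e
    ; Edge?   = λ e → (∣ e ∣ ℕ.≟ 3) ×-dec all? λ x → all? λ y →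
                  (x ∈? e) →-dec (y ∈? e) →-dec (colour x ≟ colour y) →-dec (x ≟ y)
    ; uniform = proj₁
    }

  rainbow-triple : ∀ {x y z} → Unique (colour x ∷ colour y ∷ colour z ∷ []) →
                   Edge complete3Partite (triple x y z)
  rainbow-triple {x} {y} {z} ((cx≢cy ∷ cx≢cz ∷ []) ∷ (cy≢cz ∷ []) ∷ [] ∷ []) =
    ∣triple∣≡3 (cx≢cy ∘ cong colour) (cx≢cz ∘ cong colour) (cy≢cz ∘ cong colour) , rainbow
    where
    rainbow : Rainbow (triple x y z)
    rainbow u v u∈ v∈ cu≡cv with ∈-triple⁻ u∈ | ∈-triple⁻ v∈
    ... | inj₁ refl        | inj₁ refl        = refl
    ... | inj₁ refl        | inj₂ (inj₁ refl) = contradiction cu≡cv cx≢cy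
    ... | inj₁ refl        | inj₂ (inj₂ refl) = contradiction cu≡cv cx≢cz
    ... | inj₂ (inj₁ refl) | inj₁ refl        = contradiction (sym cu≡cv) cx≢cy
    ... | inj₂ (inj₁ refl) | inj₂ (inj₁ refl) = refl
    ... | inj₂ (inj₁ refl) | inj₂ (inj₂ refl) = contradiction cu≡cv cy≢cz
    ... | inj₂ (inj₂ refl) | inj₁ refl        = contradiction (sym cu≡cv) cx≢cz
    ... | inj₂ (inj₂ refl) | inj₂ (inj₁ refl) = contradiction (sym cu≡cv) cy≢cz
    ... | inj₂ (inj₂ refl) | inj₂ (inj₂ refl) = refl

  complete3Partite-F₅-free : F₅ -Free complete3Partite
  complete3Partite-F₅-free (φ , φ-inj , φ-edge) =
    -- Four distinct colours would inject `Fin 4` into `Fin 3`.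
    ℕ.<⇒≱ ≤-refl (injective⇒≤ (λ {i} {j} → lookup-injective four-colours i j))
    where
    rainbow-edge : ∀ {x y z} → Edge complete3Partite (⁅ x ⁆ ∪ ⁅ y ⁆ ∪ ⁅ z ⁆ ∪ ⊥) →
                   Rainbow (triple x y z)
    rainbow-edge = subst Rainbow ∪-⊥≡triple ∘ proj₂

    edge₁₂₃ = rainbow-edge (φ-edge _ (here refl))
    edge₁₂₄ = rainbow-edge (φ-edge _ (there (here refl)))
    edge₃₄₅ = rainbow-edge (φ-edge _ (there (there (here refl))))

    distinct : ∀ {i j} → i ≢ j → (colour (φ i) ≡ colour (φ j) → φ i ≡ φ j) →
               colour (φ i) ≢ colour (φ j)
    distinct i≢j rainbow = i≢j ∘ φ-inj ∘ rainbow

    four-colours : Unique (colour (φ 0F) ∷ colour (φ 1F) ∷ colour (φ 2F) ∷ colour (φ 3F) ∷ [])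
    -- Each of the six pairs among the vertices 1, 2, 3, 4 lies in an edge of F₅: 12, 13, 23 in 123,
    -- then 14, 24 in 124, and 34 in 345.
    four-colours =
        ( distinct (λ ()) (edge₁₂₃ _ _ first∈triple second∈triple)
        ∷ distinct (λ ()) (edge₁₂₃ _ _ first∈triple third∈triple)
        ∷ distinct (λ ()) (edge₁₂₄ _ _ first∈triple third∈triple) ∷ [])
      ∷ ( distinct (λ ()) (edge₁₂₃ _ _ second∈triple third∈triple)
        ∷ distinct (λ ()) (edge₁₂₄ _ _ second∈triple third∈triple) ∷ [])
      ∷ ( distinct (λ ()) (edge₃₄₅ _ _ first∈triple second∈triple) ∷ [])
      ∷ [] ∷ []

  module _ (parts : ∀ c → AtLeast k (λ x → colour x ≡ c)) where

    complete3Partite-codegree : PositiveCodegree≥ complete3Partite k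
    complete3Partite-codegree x y x≢y (e , (_ , rainbow) , x∈e , y∈e)
      -- For the identity on the three colours, `avoid-two` yields the colour of neither `x` nor
      -- `y`; every vertex of that part completes the pair to an edge.
      with c , c≢cx , c≢cy ← avoid-two {f = id} id ≤-refl (colour x) (colour y)
      with f , f-inj , f-colour ← parts c
      = triple x y ∘ f
      , (λ {i} eq → f-inj (triple-injective (apart c≢cx (f-colour i)) (apart c≢cy (f-colour i)) eq))
      , λ i → rainbow-triple (unique (f-colour i)) , first∈triple , second∈triple
      where
      apart : ∀ {z w} → c ≢ colour w → colour z ≡ c → z ≢ w
      apart c≢cw cz≡c refl = c≢cw (sym cz≡c)

      unique : ∀ {z} → colour z ≡ c → Unique (colour x ∷ colour y ∷ colour z ∷ [])
      unique refl = ((x≢y ∘ rainbow x y x∈e y∈e) ∷ ≢-sym c≢cx ∷ [])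
                  ∷ (≢-sym c≢cy ∷ []) ∷ [] ∷ []

    complete3Partite-nonEmpty : 1 ≤ k → NonEmpty complete3Partite
    complete3Partite-nonEmpty (s≤s _)
      with f , _ , f-colour ← parts 0F
      with g , _ , g-colour ← parts 1F
      with h , _ , h-colour ← parts 2F
      = triple (f 0F) (g 0F) (h 0F) , rainbow-triple unique
      where
      unique : Unique (colour (f 0F) ∷ colour (g 0F) ∷ colour (h 0F) ∷ [])
      unique rewrite f-colour 0F | g-colour 0F | h-colour 0F =
        ((λ ()) ∷ (λ ()) ∷ []) ∷ ((λ ()) ∷ []) ∷ [] ∷ []

-- A balanced colouring by residues modulo 3.

residue : Fin n → Fin 3
residue x = toℕ x mod 3

-- The vertices `3 * i + c` with `i < n / 3` have residue `c`, and they stay below `n` because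
-- `n / 3 * 3 ≤ n`.
residue-classes : ∀ c → AtLeast (n / 3) (λ (x : Fin n) → residue x ≡ c)
residue-classes {n} c = f , f-injective , f-residue
  where
  f : Fin (n / 3) → Fin n
  f i = inject≤ (combine i c) (m/n*n≤m n 3)

  f-injective : Injective _≡_ _≡_ f
  f-injective {i} {j} eq =
    combine-injectiveˡ i c j c (inject≤-injective _ _ _ _ eq)

  f-residue : ∀ i → residue (f i) ≡ c
  f-residue i = toℕ-injective (begin
    toℕ (residue (f i))        ≡⟨ toℕ-fromℕ< _ ⟩
    toℕ (f i) % 3              ≡⟨ cong (_% 3) (toℕ-inject≤ (combine i c) _) ⟩
    toℕ (combine i c) % 3      ≡⟨ cong (_% 3) (toℕ-combine i c) ⟩
    (3 * toℕ i + toℕ c) % 3    ≡⟨ cong (_% 3) (ℕ.+-comm (3 * toℕ i) (toℕ c)) ⟩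
    (toℕ c + 3 * toℕ i) % 3    ≡⟨ cong (λ m → (toℕ c + m) % 3) (ℕ.*-comm 3 (toℕ i)) ⟩
    (toℕ c + toℕ i * 3) % 3    ≡⟨ [m+kn]%n≡m%n (toℕ c) (toℕ i) 3 ⟩
    toℕ c % 3                  ≡⟨ m<n⇒m%n≡m (toℕ<n c) ⟩
    toℕ c                      ∎)
    where open ≡-Reasoning

theorem7 : (n : ℕ) → 6 ≤ n → co⁺ex⟨ n , F₅ ⟩≔ (n / 3)
theorem7 n 6≤n =
    (H , nonEmpty , F₅-free
       , complete3Partite-codegree residue residue-classes
       -- The upper bound applied to `H` itself shows that its minimum positive co-degree is exactly
       -- `n / 3`.
       , λ _ → F₅-free⇒k≤n/3 H 6≤n nonEmpty F₅-free)
  , λ { _ (G , G-nonEmpty , G-F₅-free , G-codegree , _) →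
        F₅-free⇒k≤n/3 G 6≤n G-nonEmpty G-F₅-free G-codegree }
  where
  H : 3-Graph n
  H = complete3Partite residue

  nonEmpty : NonEmpty H
  nonEmpty = complete3Partite-nonEmpty residue residue-classes
    (≤-trans (s≤s z≤n) (/-monoˡ-≤ 3 6≤n))

  F₅-free : F₅ -Free H
  F₅-free = complete3Partite-F₅-free residue
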